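{- Let $n\ge 3$ be an integer and let $Fan_n$ be the fan graph, obtained from the wheel graph $W_n$ with $n$ rim vertices by removing one rim edge. Then $\mathrm{mpd}(Fan_n)=\infty$.
   Context: The wheel graph $W_n$ is obtained from a cycle on $n$ vertices (the rim) by adding one new vertex (the hub) adjacent to all rim vertices; so $Fan_n$ is a path on $n$ vertices together with one extra vertex adjacent to all vertices of the path. $d(u,v)$ denotes the shortest-path distance. Let $G$ be a connected graph and let $\Pi=\{S_1,\dots,S_t\}$ be a partition of $V(G)$ into nonempty parts. For $v\in V(G)$ put $d(v,S_i)=\min\{d(v,x):x\in S_i\}$. The multiset partition representation of $v$ with respect to $\Pi$ is the multiset $r_{mp}(v\mid\Pi)=\{d(v,S_1),\dots,d(v,S_t)\}$ (order ignored, multiplicities kept). $\Pi$ is a resolving multiset partition if $r_{mp}(u\mid\Pi)\ne r_{mp}(v\mid\Pi)$ for all distinct $u,v\in V(G)$. The multiset partition dimension $\mathrm{mpd}(G)$ is the minimum number $t$ of parts of a resolving multiset partition of $G$, and $\mathrm{mpd}(G)=\infty$ if none exists. -}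

module Defs where

open import Data.Empty using (⊥)
open import Data.Fin using (Fin; zero; suc; toℕ; fromℕ; _≟_)
open import Data.Fin.Properties using (any?)
open import Data.List using (List; tabulate)
open import Data.List.Relation.Binary.Permutation.Propositional using (_↭_)
open import Data.Nat using (ℕ; zero; suc; _≤_; z≤n; s≤s)
import Data.Nat as ℕ
open import Data.Nat.Properties using (≤-antisym; 1+n≢n)
open import Data.Product using (∃; _×_; _,_; proj₁; proj₂)
open import Data.Sum using (_⊎_; inj₁; inj₂; swap)
open import Data.Unit using (⊤; tt)
open import Function.Definitions using (StrictlySurjective)
open import Relation.Binary using (Symmetric; Decidable)
open import Relation.Binary.PropositionalEquality
open import Relation.Nullary using (¬_; yes; no; contradiction; ¬?; _×-dec_; _⊎-dec_)
open import Relation.Nullary.Construct.Add.Supremum using (_⁺; [_]; ⊤⁺)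
open import Relation.Unary using (Pred)
import Relation.Unary as U
open import Level using (0ℓ)

IsLeast : Pred ℕ 0ℓ → ℕ → Set
IsLeast P k = P k × (∀ j → P j → k ≤ j)

least : {P : Pred ℕ 0ℓ} → U.Decidable P → ∀ n → P n → ∃ (IsLeast P)
least P? n p with P? zero
least P? n       p | yes p₀ = zero , p₀ , λ _ _ → z≤n
least P? zero    p | no ¬p₀ = contradiction p ¬p₀
least {P} P? (suc n) p | no ¬p₀
  with k , q , k≤ ← least {λ j → P (suc j)} (λ j → P? (suc j)) n p
  = suc k , q , λ { zero p₀ → contradiction p₀ ¬p₀ ; (suc j) r → s≤s (k≤ j r) }

record Graph : Set₁ where
  field
    order   : ℕ
    Adj     : Fin order → Fin order → Set
    adj?    : Decidable Adj
    adj-sym : Symmetric Adj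
    irrefl  : ∀ v → ¬ Adj v v

  Vertex : Set
  Vertex = Fin order

  -- Walks from u to v with k edges; a shortest walk is a path, so the least such k
  -- is the shortest-path distance.
  Walk : ℕ → Vertex → Vertex → Set
  Walk zero    u v = u ≡ v
  Walk (suc k) u v = ∃ λ w → Adj u w × Walk k w v

  walk? : ∀ k → Decidable (Walk k)
  walk? zero    u v = u ≟ v
  walk? (suc k) u v = any? λ w → adj? u w ×-dec walk? k w v

  Connected : Set
  Connected = ∀ u v → ∃ λ k → Walk k u v

record ConnectedGraph : Set₁ where
  field
    graph     : Graph
    connected : Graph.Connected graph
  open Graph graph public

  shortest : ∀ u v → ∃ (IsLeast λ k → Walk k u v)
  shortest u v = let k , walk = connected u v in least (λ k → walk? k u v) k walk

  d : Vertex → Vertex → ℕ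
  d u v = proj₁ (shortest u v)

-- A partition of an m-element set into parts S₀ , … , Sₜ₋₁, given by the
-- function sending each element to the index of its part; surjectivity says
-- that no part is empty.  The numbering of the parts is immaterial below.
record Partition (m t : ℕ) : Set where
  field
    part     : Fin m → Fin t
    nonempty : StrictlySurjective _≡_ part

module _ (G : ConnectedGraph) where
  open ConnectedGraph G

  module _ {t : ℕ} (Π : Partition order t) where
    open Partition Π

    DistanceTo : Vertex → Fin t → Pred ℕ 0ℓ
    DistanceTo v i k = ∃ λ x → part x ≡ i × d v x ≡ k

    nearest : ∀ v i → ∃ (IsLeast (DistanceTo v i))
    nearest v i =
      let x , x∈Sᵢ = nonempty i in
      least (λ k → any? λ y → (part y ≟ i) ×-dec (d v y ℕ.≟ k)) (d v x) (x , x∈Sᵢ , refl)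

    dPart : Vertex → Fin t → ℕ
    dPart v i = proj₁ (nearest v i)

    -- Lists stand for multisets; they are compared only up to permutation.
    rmp : Vertex → List ℕ
    rmp v = tabulate (dPart v)

    Resolving : Set
    Resolving = ∀ u v → u ≢ v → ¬ (rmp u ↭ rmp v)

  HasResolvingPartition : ℕ → Set
  HasResolvingPartition t = ∃ λ (Π : Partition order t) → Resolving Π

ℕ∞ : Set
ℕ∞ = ℕ ⁺

pattern ∞ = ⊤⁺

-- mpd G ≐ x says that the multiset partition dimension of G is x.  It is the
-- graph of a partial function by mpd-unique.
mpd_≐_ : ConnectedGraph → ℕ∞ → Set
mpd G ≐ [ t ] = IsLeast (HasResolvingPartition G) t
mpd G ≐ ∞     = ¬ ∃ (HasResolvingPartition G)

mpd-unique : ∀ G {x y} → mpd G ≐ x → mpd G ≐ y → x ≡ y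
mpd-unique G {[ s ]} {[ t ]} (p , s≤) (q , t≤) = cong [_] (≤-antisym (s≤ t q) (t≤ s p))
mpd-unique G {[ s ]} {∞}     (p , _)  none     = contradiction (s , p) none
mpd-unique G {∞}     {[ t ]} none     (q , _)  = contradiction (t , q) none
mpd-unique G {∞}     {∞}     _        _        = refl

module _ {n : ℕ} where

  -- j follows i on the cycle 0 , 1 , … , n-1 , 0.
  Next : Fin n → Fin n → Set
  Next i j = toℕ j ≡ suc (toℕ i) ⊎ (suc (toℕ i) ≡ n × toℕ j ≡ 0)

  next? : Decidable Next
  next? i j = (toℕ j ℕ.≟ suc (toℕ i)) ⊎-dec ((suc (toℕ i) ℕ.≟ n) ×-dec (toℕ j ℕ.≟ 0))

  next-irrefl : 3 ≤ n → ∀ i → ¬ Next i i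
  next-irrefl _       i (inj₁ eq) = 1+n≢n (sym eq)
  next-irrefl (s≤s ()) zero (inj₂ (refl , _))

  CycleAdj : Fin n → Fin n → Set
  CycleAdj i j = Next i j ⊎ Next j i

  -- Vertex zero is the hub; the vertices suc i form the rim.
  WheelAdj : Fin (suc n) → Fin (suc n) → Set
  WheelAdj zero    zero    = ⊥
  WheelAdj zero    (suc _) = ⊤
  WheelAdj (suc _) zero    = ⊤
  WheelAdj (suc i) (suc j) = CycleAdj i j

  wheelAdj? : Decidable WheelAdj
  wheelAdj? zero    zero    = no λ ()
  wheelAdj? zero    (suc _) = yes tt
  wheelAdj? (suc _) zero    = yes tt
  wheelAdj? (suc i) (suc j) = next? i j ⊎-dec next? j i

  wheelAdj-sym : Symmetric WheelAdj
  wheelAdj-sym {zero}  {suc _} _ = tt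
  wheelAdj-sym {suc _} {zero}  _ = tt
  wheelAdj-sym {suc _} {suc _} a = swap a

  wheelAdj-irrefl : 3 ≤ n → ∀ v → ¬ WheelAdj v v
  wheelAdj-irrefl 3≤n (suc i) (inj₁ a) = next-irrefl 3≤n i a
  wheelAdj-irrefl 3≤n (suc i) (inj₂ a) = next-irrefl 3≤n i a

Wheel : (n : ℕ) → 3 ≤ n → Graph
Wheel n 3≤n = record
  { order   = suc n
  ; Adj     = WheelAdj
  ; adj?    = wheelAdj?
  ; adj-sym = λ {u} {v} → wheelAdj-sym {n} {u} {v}
  ; irrefl  = wheelAdj-irrefl 3≤n
  }

deleteEdge : (G : Graph) → Graph.Vertex G → Graph.Vertex G → Graph
deleteEdge G a b = record
  { order   = order
  ; Adj     = λ u v → Adj u v × ¬ (u ≡ a × v ≡ b) × ¬ (u ≡ b × v ≡ a)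
  ; adj?    = λ u v → adj? u v ×-dec ¬? ((u ≟ a) ×-dec (v ≟ b)) ×-dec ¬? ((u ≟ b) ×-dec (v ≟ a))
  ; adj-sym = λ (e , ≢ab , ≢ba) → adj-sym e , (λ (p , q) → ≢ba (q , p)) , (λ (p , q) → ≢ab (q , p))
  ; irrefl  = λ v (e , _) → irrefl v e
  }
  where open Graph G

-- The rim edge removed is the one joining n-1 to 0, so that the rim becomes
-- the path 0 , 1 , … , n-1.
fanGraph : (n : ℕ) → 3 ≤ n → Graph
fanGraph n@(suc m) 3≤n = deleteEdge (Wheel n 3≤n) (suc (fromℕ m)) (suc zero)

fan-connected : ∀ n 3≤n → Graph.Connected (fanGraph n 3≤n)
fan-connected (suc m) 3≤n zero    zero    = 0 , refl
fan-connected (suc m) 3≤n zero    (suc j) = 1 , suc j , (tt , (λ ()) , (λ ())) , refl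
fan-connected (suc m) 3≤n (suc i) zero    = 1 , zero , (tt , (λ ()) , (λ ())) , refl
fan-connected (suc m) 3≤n (suc i) (suc j) =
  2 , zero , (tt , (λ ()) , (λ ())) , suc j , (tt , (λ ()) , (λ ())) , refl

Fan : (n : ℕ) → 3 ≤ n → ConnectedGraph
Fan n 3≤n = record { graph = fanGraph n 3≤n ; connected = fan-connected n 3≤n }

{-# OPTIONS --safe #-}

-- In a graph of diameter at most two, r_mp(v | Π) is {0, 1^k, 2^(t-1-k)} and so
-- is determined by the number k ∈ {0, …, t-1} of ones.  By pigeonhole a
-- resolving Π has t ≥ |V|, so all parts are singletons.  Then k is the degree
-- of v, which is nonzero, so only t - 1 values remain for the |V| = t vertices.

module Submission where

open import Data.Fin using (Fin; zero; suc; inject₁; punchIn; punchOut; _≟_)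
open import Data.Fin.Properties using (pigeonhole; injective⇒≤; punchOut-injective; punchInᵢ≢i; <⇒≢)
open import Data.List using (List; _∷_; tabulate; replicate)
open import Data.List.Membership.Propositional using (_∈_; _∉_)
open import Data.List.Membership.Propositional.Properties using (∈-tabulate⁺)
open import Data.List.Relation.Binary.Permutation.Propositional
  using (_↭_; ↭-refl; ↭-reflexive; ↭-sym; ↭-trans; prep; swap)
open import Data.List.Relation.Binary.Permutation.Propositional.Properties using (∈-resp-↭)
open import Data.List.Relation.Unary.Any using (there)
open import Data.Nat using (ℕ; zero; suc; _≤_; _<_; z≤n; s≤s)
open import Data.Nat.Properties
  using (≤-refl; ≤-trans; ≤-antisym; n≤0⇒n≡0; n≢0⇒n>0; ≮⇒≥; ≤⇒≯)
open import Data.Product using (∃; _,_; proj₁; proj₂)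
open import Data.Sum using (_⊎_; inj₁; inj₂)
open import Data.Unit using (tt)
open import Function using (_∘_)
open import Function.Definitions using (StrictlySurjective)
open import Relation.Binary.PropositionalEquality
open import Relation.Nullary using (yes; no; contradiction)
open import Defs

-- Punching the omitted value out of the codomain leaves an injection into a set with one element
-- fewer.
omits⇒< : ∀ {t n} (s : Fin t → Fin n) → (∀ {y z} → s y ≡ s z → y ≡ z) →
          ∀ x → (∀ y → x ≢ s y) → t < n
omits⇒< {n = suc _} s s-injective x omits =
  s≤s (injective⇒≤ λ {y} {z} eq → s-injective (punchOut-injective (omits y) (omits z) eq))

module _ {n t : ℕ} {f : Fin n → Fin t} (surj : StrictlySurjective _≡_ f) where

  private
    section : Fin t → Fin n
    section y = proj₁ (surj y)

    f∘section : ∀ y → f (section y) ≡ y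
    f∘section y = proj₂ (surj y)

    section-injective : ∀ {y z} → section y ≡ section z → y ≡ z
    section-injective {y} {z} eq = trans (sym (f∘section y)) (trans (cong f eq) (f∘section z))

    -- Used contrapositively: a point not fixed by `section ∘ f` is omitted by the section.
    section-image : ∀ {x} y → x ≡ section y → section (f x) ≡ x
    section-image y refl = cong section (f∘section y)

  surjective⇒≤ : t ≤ n
  surjective⇒≤ = injective⇒≤ section-injective

  -- The section takes at most one of the values i and j.
  surjective∧collision⇒< : ∀ {i j} → i ≢ j → f i ≡ f j → t < n
  surjective∧collision⇒< {i} {j} i≢j fi≡fj with section (f i) ≟ i
  ... | no  s≢i = omits⇒< section section-injective i λ y i≡s → s≢i (section-image y i≡s)
  ... | yes s≡i = omits⇒< section section-injective j λ y j≡s →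
    i≢j (trans (sym s≡i) (trans (cong section fi≡fj) (section-image y j≡s)))

-- Serves to bring the entry of a vertex's own part, its only zero, to the front.
tabulate-↭-punchIn : ∀ {A : Set} {n} (f : Fin (suc n) → A) i →
                     tabulate f ↭ f i ∷ tabulate (f ∘ punchIn i)
tabulate-↭-punchIn             f zero    = ↭-refl
tabulate-↭-punchIn {n = suc _} f (suc i) =
  ↭-trans (prep _ (tabulate-↭-punchIn (f ∘ suc) i)) (swap _ _ ↭-refl)

-- The number of ones is taken in `Fin (suc m)` so that the pigeonhole principle applies to it
-- directly.
onesTwos : ∀ m → Fin (suc m) → List ℕ
onesTwos m       zero    = replicate m 2
onesTwos (suc m) (suc k) = 1 ∷ onesTwos m k

-- `inject₁` keeps the number of ones while the length grows, so the extra entry is a 2, which is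
-- then moved past the ones.
onesTwos-inject₁ : ∀ m k → onesTwos (suc m) (inject₁ k) ↭ 2 ∷ onesTwos m k
onesTwos-inject₁ m       zero    = ↭-refl
onesTwos-inject₁ (suc m) (suc k) = ↭-trans (prep 1 (onesTwos-inject₁ m k)) (swap 1 2 ↭-refl)

tabulate-↭-onesTwos : ∀ {m} (f : Fin m → ℕ) → (∀ i → f i ≡ 1 ⊎ f i ≡ 2) →
                      ∃ λ k → tabulate f ↭ onesTwos m k
tabulate-↭-onesTwos {zero}  f _ = zero , ↭-refl
tabulate-↭-onesTwos {suc m} f f∈ with tabulate-↭-onesTwos (f ∘ suc) (f∈ ∘ suc) | f∈ zero
... | k , p | inj₁ f0≡1 rewrite f0≡1 = suc k , prep 1 p
... | k , p | inj₂ f0≡2 rewrite f0≡2 = inject₁ k , ↭-trans (prep 2 p) (↭-sym (onesTwos-inject₁ m k))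

1∉replicate-2 : ∀ m → 1 ∉ replicate m 2
1∉replicate-2 (suc m) (there 1∈) = 1∉replicate-2 m 1∈

module _ (G : ConnectedGraph) where
  open ConnectedGraph G

  d≤walk : ∀ {k} u v → Walk k u v → d u v ≤ k
  d≤walk {k} u v = proj₂ (proj₂ (shortest u v)) k

  d≡0⇒≡ : ∀ u v → d u v ≡ 0 → u ≡ v
  d≡0⇒≡ u v eq = subst (λ k → Walk k u v) eq (proj₁ (proj₂ (shortest u v)))

  module _ {t : ℕ} (Π : Partition order t) where
    open Partition Π

    dPart≤d : ∀ v {x i} → part x ≡ i → dPart G Π v i ≤ d v x
    dPart≤d v {x} {i} x∈Sᵢ = proj₂ (proj₂ (nearest G Π v i)) (d v x) (x , x∈Sᵢ , refl)

    dPart-own : ∀ v → dPart G Π v (part v) ≡ 0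
    dPart-own v = n≤0⇒n≡0 (≤-trans (dPart≤d v refl) (d≤walk v v refl))

    -- The minimum is attained at some `x` of the part, and distance zero forces `x` to be `v`.
    dPart≡0⇒own : ∀ v {i} → dPart G Π v i ≡ 0 → i ≡ part v
    dPart≡0⇒own v {i} eq =
      let x , x∈Sᵢ , dx = proj₁ (proj₂ (nearest G Π v i)) in
      trans (sym x∈Sᵢ) (cong part (sym (d≡0⇒≡ v x (trans dx eq))))

    dPart-adj : ∀ {v w} → Adj v w → part w ≢ part v → dPart G Π v (part w) ≡ 1
    dPart-adj {v} {w} v~w other =
      ≤-antisym (≤-trans (dPart≤d v refl) (d≤walk v w (w , v~w , refl))) (n≢0⇒n>0 (other ∘ dPart≡0⇒own v))

  diameter≤2⇒mpd≡∞ : Vertex → (∀ v → ∃ (Adj v)) → (∀ u v → d u v ≤ 2) → mpd G ≐ ∞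
  diameter≤2⇒mpd≡∞ v₀ _ _ (zero , Π , _) with () ← Partition.part Π v₀
  diameter≤2⇒mpd≡∞ v₀ neighbour d≤2 (suc m , Π , resolving) =
    -- Removing the count zero leaves `m` possible values, while surjectivity of `part` gives at
    -- least `suc m` vertices.
    let u , v , u<v , eq = pigeonhole (surjective⇒≤ nonempty) (λ v → punchOut (ones≢0 v)) in
    resolving u v (<⇒≢ u<v) (ones-determines u v (punchOut-injective (ones≢0 u) (ones≢0 v) eq))
    where
    open Partition Π

    dPart≤2 : ∀ v i → dPart G Π v i ≤ 2
    dPart≤2 v i = let x , x∈Sᵢ = nonempty i in ≤-trans (dPart≤d Π v x∈Sᵢ) (d≤2 v x)

    1or2 : ∀ {k} → k ≢ 0 → k ≤ 2 → k ≡ 1 ⊎ k ≡ 2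
    1or2 {0} k≢0 _ = contradiction refl k≢0
    1or2 {1} _   _ = inj₁ refl
    1or2 {2} _   _ = inj₂ refl
    1or2 {suc (suc (suc _))} _ (s≤s (s≤s ()))

    others : ∀ v → ∃ λ k → tabulate (dPart G Π v ∘ punchIn (part v)) ↭ onesTwos m k
    others v = tabulate-↭-onesTwos _ λ i →
      1or2 (punchInᵢ≢i (part v) i ∘ dPart≡0⇒own Π v) (dPart≤2 v _)

    ones : Vertex → Fin (suc m)
    ones v = proj₁ (others v)

    rmp-normal : ∀ v → rmp G Π v ↭ 0 ∷ onesTwos m (ones v)
    rmp-normal v =
      ↭-trans (tabulate-↭-punchIn (dPart G Π v) (part v))
      (↭-trans (↭-reflexive (cong (_∷ tabulate (dPart G Π v ∘ punchIn (part v))) (dPart-own Π v)))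
               (prep 0 (proj₂ (others v))))

    ones-determines : ∀ u v → ones u ≡ ones v → rmp G Π u ↭ rmp G Π v
    ones-determines u v eq =
      ↭-trans (rmp-normal u)
      (↭-trans (↭-reflexive (cong (λ k → 0 ∷ onesTwos m k) eq)) (↭-sym (rmp-normal v)))

    -- Otherwise two vertices would share one of the `suc m` possible counts and hence their
    -- representation.
    order≤t : order ≤ suc m
    order≤t = ≮⇒≥ λ t<order →
      let u , v , u<v , eq = pigeonhole t<order ones in
      resolving u v (<⇒≢ u<v) (ones-determines u v eq)

    ones≢0 : ∀ v → zero ≢ ones v
    ones≢0 v 0≡ones with w , v~w ← neighbour v with part w ≟ part v
    -- Two adjacent, hence distinct, vertices in one part would make the parts fewer than the
    -- vertices.
    ... | yes same = ≤⇒≯ order≤t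
      (surjective∧collision⇒< nonempty (λ { refl → irrefl v v~w }) same)
    ... | no other with ∈-resp-↭ (rmp-normal v)
                          (subst (_∈ rmp G Π v) (dPart-adj Π v~w other)
                            (∈-tabulate⁺ {f = dPart G Π v} (part w)))
    -- The entry 1 coming from the neighbour's part cannot be the leading 0, so it would lie among
    -- the remaining entries, which are all 2 when the count is zero.
    ...   | there 1∈ = 1∉replicate-2 m (subst (λ k → 1 ∈ onesTwos m k) (sym 0≡ones) 1∈)

-- Every spoke survives the deletion, since the deleted edge has both ends on the rim.
fan-neighbour : ∀ n 3≤n v → ∃ (ConnectedGraph.Adj (Fan n 3≤n) v)
fan-neighbour (suc _) _ zero    = suc zero , tt , (λ ()) , (λ ())
fan-neighbour (suc _) _ (suc _) = zero , tt , (λ ()) , (λ ())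

-- The walks that witness connectedness pass between rim vertices through the hub, so they also
-- bound the diameter.
fan-walk≤2 : ∀ n 3≤n u v → proj₁ (fan-connected n 3≤n u v) ≤ 2
fan-walk≤2 (suc _) _ zero    zero    = z≤n
fan-walk≤2 (suc _) _ zero    (suc _) = s≤s z≤n
fan-walk≤2 (suc _) _ (suc _) zero    = s≤s z≤n
fan-walk≤2 (suc _) _ (suc _) (suc _) = ≤-refl

fan-vertex : ∀ n 3≤n → ConnectedGraph.Vertex (Fan n 3≤n)
fan-vertex (suc _) _ = zero

theorem4p4 : (n : ℕ) (3≤n : 3 ≤ n) → mpd (Fan n 3≤n) ≐ ∞
theorem4p4 n 3≤n =
  diameter≤2⇒mpd≡∞ (Fan n 3≤n) (fan-vertex n 3≤n) (fan-neighbour n 3≤n) λ u v →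
    ≤-trans (d≤walk (Fan n 3≤n) u v (proj₂ (fan-connected n 3≤n u v))) (fan-walk≤2 n 3≤n u v)
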